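{- Let $M$ be a matroid on a finite ground set $E$, let $k\geq 2$ be an integer, let $B_1,\dots,B_k$ be bases of $M$, and let $A_1\subset B_1$. Then there exist subsets $A_2\subset B_2,\dots,A_k\subset B_k$ such that for every $i\in\{1,\dots,k\}$ the set $(B_i\setminus A_i)\cup A_{i-1}$ is a basis of $M$, where indices are taken cyclically, i.e. $A_0:=A_k$.
   Context: The bases $B_1,\dots,B_k$ need not be distinct or disjoint. The sets $(B_i\setminus A_i)\cup A_{i-1}$ are those obtained by cyclically shifting the subsets $A_i$ by one position. -}

module Defs where

open import Level using (Level; suc; _⊔_)
open import Data.Nat as ℕ using (ℕ; _<_)
open import Data.Fin using (Fin)
open import Data.Fin.Subset using (Subset; ⊥; _∈_; _∉_; _⊆_; _∪_; ⁅_⁆; ∣_∣)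
open import Data.Product using (Σ; _×_; ∃-syntax)

record Matroid (n : ℕ) : Set₁ where
  field
    Indep         : Subset n → Set
    empty-indep   : Indep ⊥
    indep-down    : ∀ {X Y} → X ⊆ Y → Indep Y → Indep X
    augmentation  : ∀ {X Y} → Indep X → Indep Y → ∣ X ∣ < ∣ Y ∣ →
                    ∃[ e ] (e ∈ Y × e ∉ X × Indep (X ∪ ⁅ e ⁆))

  IsBasis : Subset n → Set
  IsBasis B = Indep B × (∀ {X} → Indep X → B ⊆ X → X ⊆ B)

open Matroid public

open import Data.Fin using (zero; suc; fromℕ; inject₁)

prev : ∀ {m} → Fin (ℕ.suc m) → Fin (ℕ.suc m)
prev {m} zero    = fromℕ m
prev     (suc i) = inject₁ i

{-# OPTIONS --safe #-}

-- Everything rests on the symmetric exchange property, in the form: if A ∪ C is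
-- a basis with A, C disjoint, then a basis B has a subset D such that
-- (B ─ D) ∪ A and C ∪ D are bases.  Starting from A = A₁ and C = B₁ ─ A₁ and
-- replacing A by D at each step, one passes through B₂, …, B_k one at a time,
-- and the set D obtained from B_k closes the cycle because C ∪ D is a basis.
--
-- For the exchange property, the elements of B are distributed one at a time to
-- A (becoming part of B ─ D) and to C (becoming part of D), maintaining, with R
-- the set of elements still to be distributed,
--   r (X ∪ A) + r (X ∪ C) ≥ t + ∣ X ∣  for all X ⊆ R,   t + ∣ R ∣ constant.
-- If neither choice for e ∈ R were possible, sets X, Y ⊆ R - e violating the two
-- resulting conditions would, by submodularity, contradict the invariant at
-- X ∪ Y ∪ ⁅ e ⁆ and X ∩ Y.
--
-- Independence is not decidable, so there is no rank function; r (P) ≥ s is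
-- expressed by exhibiting an independent subset of P of size at least s.  One of
-- the two choices for e is then found by showing, for each pair X, Y, that one of
-- the two conditions holds, as a finite ∀ distributes over ⊎.

module Submission where

open import Defs
open import Data.Nat as ℕ using (ℕ; _≥_)
open import Data.Fin using (Fin; zero)
open import Data.Fin.Subset using (Subset; _⊆_; _∪_; _─_)
open import Data.Product using (Σ; _×_; ∃-syntax)
open import Relation.Binary.PropositionalEquality using (_≡_)

open import Data.Bool using (true; false)
open import Data.Fin using (suc; fromℕ; inject₁)
open import Data.Fin.Subset using (outside; ⊥; _∈_; _∉_; _∩_; _-_; ⁅_⁆; ∣_∣; _⊂_)
open import Data.Fin.Subset.Properties
open import Data.Fin.Subset.Induction using (Acc; acc; ⊂-wellFounded)
open import Data.Nat using (suc; _+_; _≤_; _<_)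
open import Data.Nat.Properties as ℕₚ using
  ( ≤-reflexive; ≤-trans; <⇒≱; ≰⇒>; m≤m+n; +-suc; +-comm
  ; +-mono-≤; +-monoˡ-≤; +-monoʳ-≤; +-cancelˡ-≤; +-cancelʳ-≤; module ≤-Reasoning )
open import Data.Product using (_,_; proj₁)
open import Data.Sum as Sum using (_⊎_; inj₁; inj₂; [_,_]′; swap; map₁)
open import Data.Vec using ([]; _∷_; here; there)
open import Function using (_∘_; id)
open import Relation.Binary.PropositionalEquality using (refl; sym; trans; cong; subst)
open import Relation.Nullary using (yes; no; contradiction)
open import Algebra.Properties.CommutativeSemigroup ℕₚ.+-commutativeSemigroup using (interchange)

private
  variable
    n : ℕ
    p q r : Subset n

-- Arithmetic and cardinalities of finite subsets.

suc[m+n]≤o+p⇒m<o⊎n<p : ∀ m n {o p} → suc (m + n) ≤ o + p → m < o ⊎ n < p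
suc[m+n]≤o+p⇒m<o⊎n<p m n {o} {p} h with suc m ℕ.≤? o
... | yes m<o = inj₁ m<o
... | no  m≮o = inj₂ (+-cancelˡ-≤ m (suc n) p
  (≤-trans (≤-reflexive (+-suc m n)) (≤-trans h (+-monoˡ-≤ p (ℕ.s≤s⁻¹ (≰⇒> m≮o))))))

m+m≤o+p∧p≤m⇒m≤o : ∀ m {o p} → m + m ≤ o + p → p ≤ m → m ≤ o
m+m≤o+p∧p≤m⇒m≤o m {o} h p≤m = +-cancelʳ-≤ m m o (≤-trans h (+-monoʳ-≤ o p≤m))

∪-least : p ⊆ r → q ⊆ r → p ∪ q ⊆ r
∪-least {p = p} {q = q} p⊆r q⊆r = [ p⊆r , q⊆r ]′ ∘ x∈p∪q⁻ p q

∩-greatest : r ⊆ p → r ⊆ q → r ⊆ p ∩ q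
∩-greatest r⊆p r⊆q x∈r = x∈p∩q⁺ (r⊆p x∈r , r⊆q x∈r)

⁅⁆⊆ : ∀ {x} → x ∈ p → ⁅ x ⁆ ⊆ p
⁅⁆⊆ {p = p} {x} x∈p y∈⁅x⁆ = subst (_∈ p) (sym (x∈⁅y⁆⇒x≡y x y∈⁅x⁆)) x∈p

x∈p─q⇒x∉q : ∀ (p q : Subset n) {x} → x ∈ p ─ q → x ∉ q
x∈p─q⇒x∉q (_ ∷ p)      (outside ∷ q) here      ()
x∈p─q⇒x∉q (_ ∷ p)      (_ ∷ q)       (there m) (there m′) = x∈p─q⇒x∉q p q m m′

p⊆p─q∪q : ∀ (p q : Subset n) → p ⊆ (p ─ q) ∪ q
p⊆p─q∪q p q {x} x∈p with x ∈? q
... | yes x∈q = q⊆p∪q (p ─ q) q x∈q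
... | no  x∉q = p⊆p∪q q (x∈p∧x∉q⇒x∈p─q x∈p x∉q)

p⊆q∧∣q∣≤∣p∣⇒q⊆p : p ⊆ q → ∣ q ∣ ≤ ∣ p ∣ → q ⊆ p
p⊆q∧∣q∣≤∣p∣⇒q⊆p {p = p} p⊆q ∣q∣≤∣p∣ {x} x∈q with x ∈? p
... | yes x∈p = x∈p
... | no  x∉p = contradiction ∣q∣≤∣p∣ (<⇒≱ (p⊂q⇒∣p∣<∣q∣ (p⊆q , x , x∈q , x∉p)))

x∉p⇒∣p∣<∣p∪⁅x⁆∣ : ∀ {x} → x ∉ p → ∣ p ∣ < ∣ p ∪ ⁅ x ⁆ ∣
x∉p⇒∣p∣<∣p∪⁅x⁆∣ {p = p} {x} x∉p =
  p⊂q⇒∣p∣<∣q∣ (p⊆p∪q ⁅ x ⁆ , x , q⊆p∪q p ⁅ x ⁆ (x∈⁅x⁆ x) , x∉p)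

∣p∪q∣+∣p∩q∣≡∣p∣+∣q∣ : ∀ (p q : Subset n) → ∣ p ∪ q ∣ + ∣ p ∩ q ∣ ≡ ∣ p ∣ + ∣ q ∣
∣p∪q∣+∣p∩q∣≡∣p∣+∣q∣ []          []          = refl
∣p∪q∣+∣p∩q∣≡∣p∣+∣q∣ (true ∷ p)  (true ∷ q)  = cong suc (trans (+-suc _ _)
  (trans (cong suc (∣p∪q∣+∣p∩q∣≡∣p∣+∣q∣ p q)) (sym (+-suc _ _))))
∣p∪q∣+∣p∩q∣≡∣p∣+∣q∣ (true ∷ p)  (false ∷ q) = cong suc (∣p∪q∣+∣p∩q∣≡∣p∣+∣q∣ p q)
∣p∪q∣+∣p∩q∣≡∣p∣+∣q∣ (false ∷ p) (true ∷ q)  =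
  trans (cong suc (∣p∪q∣+∣p∩q∣≡∣p∣+∣q∣ p q)) (sym (+-suc _ _))
∣p∪q∣+∣p∩q∣≡∣p∣+∣q∣ (false ∷ p) (false ∷ q) = ∣p∪q∣+∣p∩q∣≡∣p∣+∣q∣ p q

∣p∪q∣≤∣p∣+∣q∣ : ∀ (p q : Subset n) → ∣ p ∪ q ∣ ≤ ∣ p ∣ + ∣ q ∣
∣p∪q∣≤∣p∣+∣q∣ p q = ≤-trans (m≤m+n _ _) (≤-reflexive (∣p∪q∣+∣p∩q∣≡∣p∣+∣q∣ p q))

∣p─q∣+∣p∩q∣≡∣p∣ : ∀ (p q : Subset n) → ∣ p ─ q ∣ + ∣ p ∩ q ∣ ≡ ∣ p ∣
∣p─q∣+∣p∩q∣≡∣p∣ []          []          = refl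
∣p─q∣+∣p∩q∣≡∣p∣ (true ∷ p)  (true ∷ q)  = trans (+-suc _ _) (cong suc (∣p─q∣+∣p∩q∣≡∣p∣ p q))
∣p─q∣+∣p∩q∣≡∣p∣ (true ∷ p)  (false ∷ q) = cong suc (∣p─q∣+∣p∩q∣≡∣p∣ p q)
∣p─q∣+∣p∩q∣≡∣p∣ (false ∷ p) (true ∷ q)  = ∣p─q∣+∣p∩q∣≡∣p∣ p q
∣p─q∣+∣p∩q∣≡∣p∣ (false ∷ p) (false ∷ q) = ∣p─q∣+∣p∩q∣≡∣p∣ p q

q⊆p⇒∣p─q∣+∣q∣≡∣p∣ : q ⊆ p → ∣ p ─ q ∣ + ∣ q ∣ ≡ ∣ p ∣
q⊆p⇒∣p─q∣+∣q∣≡∣p∣ {q = q} {p = p} q⊆p = trans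
  (cong (λ s → ∣ p ─ q ∣ + ∣ s ∣) (⊆-antisym (∩-greatest q⊆p id) (p∩q⊆q p q)))
  (∣p─q∣+∣p∩q∣≡∣p∣ p q)

x∈p⇒suc∣p-x∣≡∣p∣ : ∀ {x} → x ∈ p → suc ∣ p - x ∣ ≡ ∣ p ∣
x∈p⇒suc∣p-x∣≡∣p∣ {p = p} {x} x∈p = trans (+-comm 1 _)
  (trans (cong (∣ p - x ∣ +_) (sym (∣⁅x⁆∣≡1 x))) (q⊆p⇒∣p─q∣+∣q∣≡∣p∣ (⁅⁆⊆ x∈p)))

suc[m]+∣p-x∣≡m+∣p∣ : ∀ m {x} → x ∈ p → suc m + ∣ p - x ∣ ≡ m + ∣ p ∣
suc[m]+∣p-x∣≡m+∣p∣ m x∈p = trans (sym (+-suc m _)) (cong (m +_) (x∈p⇒suc∣p-x∣≡∣p∣ x∈p))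

-- Constructive because there are finitely many `X`: the recursion visits them all by splitting on
-- membership of the first element, and returns any `K` it meets.
∀-⊎ : ∀ {P : Subset n → Set} {K : Set} → (∀ X → P X ⊎ K) → (∀ X → P X) ⊎ K
∀-⊎ {ℕ.zero}  f = map₁ (λ { h [] → h }) (f [])
∀-⊎ {ℕ.suc n} f with ∀-⊎ (f ∘ (true ∷_)) | ∀-⊎ (f ∘ (false ∷_))
... | inj₂ k | _      = inj₂ k
... | inj₁ _ | inj₂ k = inj₂ k
... | inj₁ g | inj₁ h = inj₁ λ { (true ∷ X) → g X ; (false ∷ X) → h X }

∀⊆-⊎ : ∀ {P : Subset n → Set} {K : Set} →
       (∀ X → X ⊆ r → P X ⊎ K) → (∀ X → X ⊆ r → P X) ⊎ K
∀⊆-⊎ {r = r} {P} {K} f = ∀-⊎ g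
  where
  g : ∀ X → (X ⊆ r → P X) ⊎ K
  g X with X ⊆? r
  ... | yes X⊆r = map₁ (λ h _ → h) (f X X⊆r)
  ... | no  X⊈r = inj₁ (λ X⊆r → contradiction (λ {x} → X⊆r {x}) X⊈r)

-- Two passes: for fixed `X`, range over `Y` with `P X` as the fixed alternative; then range over
-- `X` with the whole family of `Q Y` as the fixed one.
∀⊆-⊎-∀⊆ : ∀ {P Q : Subset n → Set} → (∀ X Y → X ⊆ r → Y ⊆ r → P X ⊎ Q Y) →
          (∀ X → X ⊆ r → P X) ⊎ (∀ Y → Y ⊆ r → Q Y)
∀⊆-⊎-∀⊆ f = ∀⊆-⊎ λ X X⊆r → swap (∀⊆-⊎ λ Y Y⊆r → swap (f X Y X⊆r Y⊆r))

-- Augmentation and submodularity in a matroid.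

module _ (M : Matroid n) where

  -- The fuel `k` bounds the deficit of `∣ I ∣` against `∣ J ∣`, which each added element lowers.
  augment : ∀ k {I J} → Indep M I → Indep M J → ∣ J ∣ ≤ k + ∣ I ∣ →
            ∃[ K ] (Indep M K × I ⊆ K × K ⊆ I ∪ J × ∣ J ∣ ≤ ∣ K ∣)
  augment ℕ.zero {I} {J} indI _ ∣J∣≤∣I∣ = I , indI , id , p⊆p∪q J , ∣J∣≤∣I∣
  augment (suc k) {I} {J} indI indJ ∣J∣≤k+∣I∣ with ∣ J ∣ ℕ.≤? ∣ I ∣
  ... | yes ∣J∣≤∣I∣ = I , indI , id , p⊆p∪q J , ∣J∣≤∣I∣
  ... | no  ∣J∣≰∣I∣ with augmentation M indI indJ (≰⇒> ∣J∣≰∣I∣)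
  ... | e , e∈J , e∉I , indI′ with augment k indI′ indJ
        (≤-trans ∣J∣≤k+∣I∣ (≤-trans (≤-reflexive (sym (+-suc k _))) (+-monoʳ-≤ k (x∉p⇒∣p∣<∣p∪⁅x⁆∣ e∉I))))
  ... | K , indK , I′⊆K , K⊆I′∪J , ∣J∣≤∣K∣ =
    K , indK , I′⊆K ∘ p⊆p∪q ⁅ e ⁆ ,
    ∪-least (∪-least (p⊆p∪q J) (⁅⁆⊆ (q⊆p∪q I J e∈J))) (q⊆p∪q I J) ∘ K⊆I′∪J , ∣J∣≤∣K∣

  -- r (P) + r (Q) ≥ s
  RankSum≥ : Subset n → Subset n → ℕ → Set
  RankSum≥ P Q s = ∃[ I ] ∃[ J ] (Indep M I × Indep M J × I ⊆ P × J ⊆ Q × s ≤ ∣ I ∣ + ∣ J ∣)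

  -- Extend `J` inside `J ∪ I` to `K` with `∣ I ∣ ≤ ∣ K ∣`. The traces `K ∩ P` and `K ∩ Q` cover `K`
  -- and both contain `J`, so inclusion-exclusion gives the bound.
  submodular : ∀ {P Q I J} → Indep M I → Indep M J → I ⊆ P ∪ Q → J ⊆ P ∩ Q →
               RankSum≥ P Q (∣ I ∣ + ∣ J ∣)
  submodular {P} {Q} {I} {J} indI indJ I⊆P∪Q J⊆P∩Q
    with augment ∣ I ∣ indJ indI (m≤m+n _ _)
  ... | K , indK , J⊆K , K⊆J∪I , ∣I∣≤∣K∣ =
    K ∩ P , K ∩ Q ,
    indep-down M (p∩q⊆p K P) indK , indep-down M (p∩q⊆p K Q) indK ,
    p∩q⊆q K P , p∩q⊆q K Q ,
    (begin
      ∣ I ∣ + ∣ J ∣                                 ≤⟨ +-mono-≤ (≤-trans ∣I∣≤∣K∣ (p⊆q⇒∣p∣≤∣q∣ K⊆∪)) (p⊆q⇒∣p∣≤∣q∣ J⊆∩) ⟩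
      ∣ (K ∩ P) ∪ (K ∩ Q) ∣ + ∣ (K ∩ P) ∩ (K ∩ Q) ∣ ≡⟨ ∣p∪q∣+∣p∩q∣≡∣p∣+∣q∣ (K ∩ P) (K ∩ Q) ⟩
      ∣ K ∩ P ∣ + ∣ K ∩ Q ∣                         ∎)
    where
    open ≤-Reasoning
    J⊆P : J ⊆ P
    J⊆P = p∩q⊆p P Q ∘ J⊆P∩Q
    J⊆Q : J ⊆ Q
    J⊆Q = p∩q⊆q P Q ∘ J⊆P∩Q
    J⊆∩ : J ⊆ (K ∩ P) ∩ (K ∩ Q)
    J⊆∩ = ∩-greatest (∩-greatest J⊆K J⊆P) (∩-greatest J⊆K J⊆Q)
    K⊆∪ : K ⊆ (K ∩ P) ∪ (K ∩ Q)
    K⊆∪ x∈K with x∈p∪q⁻ P Q (∪-least (p⊆p∪q Q ∘ J⊆P) I⊆P∪Q (K⊆J∪I x∈K))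
    ... | inj₁ x∈P = p⊆p∪q (K ∩ Q) (x∈p∩q⁺ (x∈K , x∈P))
    ... | inj₂ x∈Q = q⊆p∪q (K ∩ P) (K ∩ Q) (x∈p∩q⁺ (x∈K , x∈Q))

  -- Distributing elements between two sets.

  Distributable : Subset n → Subset n → Subset n → ℕ → Set
  Distributable R A C t = ∀ X → X ⊆ R → RankSum≥ (X ∪ A) (X ∪ C) (t + ∣ X ∣)

  distribute-one : ∀ {R A C t e} → e ∈ R → Distributable R A C t →
                   Distributable (R - e) (A ∪ ⁅ e ⁆) C (suc t) ⊎
                   Distributable (R - e) A (C ∪ ⁅ e ⁆) (suc t)
  distribute-one {R} {A} {C} {t} {e} e∈R h = ∀⊆-⊎-∀⊆ choose
    where
    choose : ∀ X Y → X ⊆ R - e → Y ⊆ R - e →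
             RankSum≥ (X ∪ (A ∪ ⁅ e ⁆)) (X ∪ C) (suc t + ∣ X ∣) ⊎
             RankSum≥ (Y ∪ A) (Y ∪ (C ∪ ⁅ e ⁆)) (suc t + ∣ Y ∣)
    choose X Y X⊆ Y⊆
      with h ((X ∪ Y) ∪ ⁅ e ⁆) (∪-least (∪-least (R-e⊆R ∘ X⊆) (R-e⊆R ∘ Y⊆)) (⁅⁆⊆ e∈R))
         | h (X ∩ Y) (R-e⊆R ∘ X⊆ ∘ p∩q⊆p X Y)
      where
      R-e⊆R : R - e ⊆ R
      R-e⊆R = p─q⊆p R ⁅ e ⁆
    ... | I , J , indI , indJ , I⊆ , J⊆ , I+J | I′ , J′ , indI′ , indJ′ , I′⊆ , J′⊆ , I′+J′
      -- The `A` sides and the `C` sides are uncrossed separately; `e` goes with `X` in the first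
      -- pair and with `Y` in the second.
      with submodular {X ∪ (A ∪ ⁅ e ⁆)} {Y ∪ A} indI indI′
             (∪-least (∪-least (∪-least (inl ∘ inl) (inr ∘ inl)) (inl ∘ inr ∘ inr)) (inr ∘ inr) ∘ I⊆)
             (∩-greatest (∪-least (inl ∘ p∩q⊆p X Y) (inr ∘ inl)) (∪-least (inl ∘ p∩q⊆q X Y) inr) ∘ I′⊆)
         | submodular {X ∪ C} {Y ∪ (C ∪ ⁅ e ⁆)} indJ indJ′
             (∪-least (∪-least (∪-least (inl ∘ inl) (inr ∘ inl)) (inr ∘ inr ∘ inr)) (inl ∘ inr) ∘ J⊆)
             (∩-greatest (∪-least (inl ∘ p∩q⊆p X Y) inr) (∪-least (inl ∘ p∩q⊆q X Y) (inr ∘ inl)) ∘ J′⊆)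
      where
      inl : ∀ {p q : Subset n} → p ⊆ p ∪ q
      inl {q = q} = p⊆p∪q q
      inr : ∀ {p q : Subset n} → q ⊆ p ∪ q
      inr {p} {q} = q⊆p∪q p q
    ... | K₁ , K₂ , indK₁ , indK₂ , K₁⊆ , K₂⊆ , K₁+K₂ | L₁ , L₂ , indL₁ , indL₂ , L₁⊆ , L₂⊆ , L₁+L₂
      = Sum.map
        (λ le → K₁ , L₁ , indK₁ , indL₁ , K₁⊆ , L₁⊆ , le)
        (λ le → K₂ , L₂ , indK₂ , indL₂ , K₂⊆ , L₂⊆ , le)
        (suc[m+n]≤o+p⇒m<o⊎n<p (t + ∣ X ∣) (t + ∣ Y ∣) total)
      where
      open ≤-Reasoning
      e∉R-e : e ∉ R - e
      e∉R-e e∈ = x∈p─q⇒x∉q R ⁅ e ⁆ e∈ (x∈⁅x⁆ e)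
      -- The extra unit comes from `e` lying outside `X ∪ Y`; it forces one of the two regrouped
      -- sums strictly past its bound.
      total : suc ((t + ∣ X ∣) + (t + ∣ Y ∣)) ≤ (∣ K₁ ∣ + ∣ L₁ ∣) + (∣ K₂ ∣ + ∣ L₂ ∣)
      total = begin
        suc ((t + ∣ X ∣) + (t + ∣ Y ∣))
          ≡⟨ cong suc (interchange t _ t _) ⟩
        suc ((t + t) + (∣ X ∣ + ∣ Y ∣))
          ≡⟨ cong (λ s → suc ((t + t) + s)) (∣p∪q∣+∣p∩q∣≡∣p∣+∣q∣ X Y) ⟨
        suc ((t + t) + (∣ X ∪ Y ∣ + ∣ X ∩ Y ∣))
          ≡⟨ +-suc (t + t) _ ⟨
        (t + t) + (suc ∣ X ∪ Y ∣ + ∣ X ∩ Y ∣)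
          ≤⟨ +-monoʳ-≤ (t + t) (+-monoˡ-≤ _ (x∉p⇒∣p∣<∣p∪⁅x⁆∣ (e∉R-e ∘ ∪-least X⊆ Y⊆))) ⟩
        (t + t) + (∣ (X ∪ Y) ∪ ⁅ e ⁆ ∣ + ∣ X ∩ Y ∣)
          ≡⟨ interchange t t _ _ ⟩
        (t + ∣ (X ∪ Y) ∪ ⁅ e ⁆ ∣) + (t + ∣ X ∩ Y ∣)
          ≤⟨ +-mono-≤ I+J I′+J′ ⟩
        (∣ I ∣ + ∣ J ∣) + (∣ I′ ∣ + ∣ J′ ∣)
          ≡⟨ interchange ∣ I ∣ _ _ _ ⟩
        (∣ I ∣ + ∣ I′ ∣) + (∣ J ∣ + ∣ J′ ∣)
          ≤⟨ +-mono-≤ K₁+K₂ L₁+L₂ ⟩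
        (∣ K₁ ∣ + ∣ K₂ ∣) + (∣ L₁ ∣ + ∣ L₂ ∣)
          ≡⟨ interchange ∣ K₁ ∣ _ _ _ ⟩
        (∣ K₁ ∣ + ∣ L₁ ∣) + (∣ K₂ ∣ + ∣ L₂ ∣) ∎

  -- `D` collects the elements given to `C`. Once `R` is empty, the invariant at `⊥` is the claim.
  distribute : ∀ {R} → Acc _⊂_ R → ∀ {A C t} → Distributable R A C t →
               ∃[ D ] (D ⊆ R × RankSum≥ ((R ─ D) ∪ A) (C ∪ D) (t + ∣ R ∣))
  distribute {R} (acc rec) {A} {C} {t} h with nonempty? R
  ... | no R-empty rewrite Empty-unique R-empty = ⊥ , id , finish (h ⊥ id)
    where
    finish : RankSum≥ (⊥ ∪ A) (⊥ ∪ C) (t + ∣ ⊥ {n} ∣) → RankSum≥ ((⊥ ─ ⊥) ∪ A) (C ∪ ⊥) (t + ∣ ⊥ {n} ∣)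
    finish (I , J , indI , indJ , I⊆ , J⊆ , le) = I , J , indI , indJ ,
      ∪-least ⊥⊆ (q⊆p∪q (⊥ ─ ⊥) A) ∘ I⊆ , ∪-least ⊥⊆ (p⊆p∪q ⊥) ∘ J⊆ , le
  ... | yes (e , e∈R) with distribute-one e∈R h
  ... | inj₁ h′ with distribute (rec (x∈p⇒p-x⊂p e∈R)) h′
  ... | D , D⊆ , I , J , indI , indJ , I⊆ , J⊆ , le =
    D , p─q⊆p R ⁅ e ⁆ ∘ D⊆ , I , J , indI , indJ ,
    ∪-least (p⊆p∪q A ∘ R-e─D⊆R─D)
      (∪-least (q⊆p∪q (R ─ D) A) (⁅⁆⊆ (p⊆p∪q A (x∈p∧x∉q⇒x∈p─q e∈R e∉D)))) ∘ I⊆ ,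
    J⊆ ,
    subst (_≤ ∣ I ∣ + ∣ J ∣) (suc[m]+∣p-x∣≡m+∣p∣ t e∈R) le
    where
    e∉D : e ∉ D
    e∉D e∈D = x∈p─q⇒x∉q R ⁅ e ⁆ (D⊆ e∈D) (x∈⁅x⁆ e)
    R-e─D⊆R─D : (R - e) ─ D ⊆ R ─ D
    R-e─D⊆R─D x∈ = x∈p∧x∉q⇒x∈p─q (p─q⊆p R ⁅ e ⁆ (p─q⊆p (R - e) D x∈)) (x∈p─q⇒x∉q (R - e) D x∈)
  distribute {R} (acc rec) {A} {C} {t} h | yes (e , e∈R) | inj₂ h′
    with distribute (rec (x∈p⇒p-x⊂p e∈R)) h′
  ... | D , D⊆ , I , J , indI , indJ , I⊆ , J⊆ , le =
    D ∪ ⁅ e ⁆ , ∪-least (p─q⊆p R ⁅ e ⁆ ∘ D⊆) (⁅⁆⊆ e∈R) , I , J , indI , indJ ,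
    subst (λ S → I ⊆ S ∪ A) (trans (p─q─r≡p─q∪r R ⁅ e ⁆ D) (cong (R ─_) (∪-comm ⁅ e ⁆ D))) I⊆ ,
    subst (J ⊆_) (trans (∪-assoc C ⁅ e ⁆ D) (cong (C ∪_) (∪-comm ⁅ e ⁆ D))) J⊆ ,
    subst (_≤ ∣ I ∣ + ∣ J ∣) (suc[m]+∣p-x∣≡m+∣p∣ t e∈R) le

  -- Symmetric exchange and the chain of bases.

  IndepOfSize≥ : ℕ → Subset n → Set
  IndepOfSize≥ ρ X = Indep M X × ρ ≤ ∣ X ∣

  IsBasis⇒∣X∣≤∣B∣ : ∀ {B X} → IsBasis M B → Indep M X → ∣ X ∣ ≤ ∣ B ∣
  IsBasis⇒∣X∣≤∣B∣ {B} {X} (indB , maxB) indX with ∣ X ∣ ℕ.≤? ∣ B ∣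
  ... | yes ∣X∣≤∣B∣ = ∣X∣≤∣B∣
  ... | no  ∣X∣≰∣B∣ with augmentation M indB indX (≰⇒> ∣X∣≰∣B∣)
  ... | e , _ , e∉B , indB∪e =
    contradiction (maxB indB∪e (p⊆p∪q ⁅ e ⁆) (q⊆p∪q B ⁅ e ⁆ (x∈⁅x⁆ e))) e∉B

  module _ {ρ : ℕ} (ρ-bound : ∀ {X} → Indep M X → ∣ X ∣ ≤ ρ) where

    -- Since `ρ` bounds all independent sets, sizes can be carried through the exchanges in place of
    -- maximality.
    IndepOfSize≥⇒IsBasis : ∀ {X} → IndepOfSize≥ ρ X → IsBasis M X
    IndepOfSize≥⇒IsBasis (indX , ρ≤∣X∣) =
      indX , λ indY X⊆Y → p⊆q∧∣q∣≤∣p∣⇒q⊆p X⊆Y (≤-trans (ρ-bound indY) ρ≤∣X∣)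

    -- Abstract because `with exchange …` would otherwise normalise the recursion in distribute.
    abstract
      exchange : ∀ {A C B} → IndepOfSize≥ ρ (A ∪ C) → ∣ A ∣ + ∣ C ∣ ≤ ρ → IndepOfSize≥ ρ B →
                 ∃[ D ] (D ⊆ B × IndepOfSize≥ ρ ((B ─ D) ∪ A) × IndepOfSize≥ ρ (C ∪ D) × ∣ D ∣ + ∣ C ∣ ≤ ρ)
      exchange {A} {C} {B} (indA∪C , ρ≤∣A∪C∣) ∣A∣+∣C∣≤ρ (indB , ρ≤∣B∣)
        with distribute (⊂-wellFounded B) distributable
        where
        -- Submodularity for `X ∪ A` and `X ∪ C`: their union contains the large set `A ∪ C`, their
        -- intersection the independent set `X`.
        distributable : Distributable B A C ρ
        distributable X X⊆B
          with submodular {X ∪ A} {X ∪ C} indA∪C (indep-down M X⊆B indB)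
                 (∪-least (p⊆p∪q _ ∘ q⊆p∪q X A) (q⊆p∪q (X ∪ A) _ ∘ q⊆p∪q X C))
                 (∩-greatest (p⊆p∪q A) (p⊆p∪q C))
        ... | I , J , indI , indJ , I⊆ , J⊆ , le =
          I , J , indI , indJ , I⊆ , J⊆ , ≤-trans (+-monoˡ-≤ ∣ X ∣ ρ≤∣A∪C∣) le
      ... | D , D⊆B , I , J , indI , indJ , I⊆ , J⊆ , le =
        D , D⊆B ,
        (indep-down M (p⊆q∧∣q∣≤∣p∣⇒q⊆p I⊆ (≤-trans ∣B─D∪A∣≤ρ ρ≤∣I∣)) indI , ρ≤∣B─D∪A∣) ,
        (indep-down M (p⊆q∧∣q∣≤∣p∣⇒q⊆p J⊆ (≤-trans ∣C∪D∣≤ρ ρ≤∣J∣)) indJ , ρ≤∣C∪D∣) ,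
        ∣D∣+∣C∣≤ρ
        where
        open ≤-Reasoning
        -- Neither `I` nor `J` exceeds `ρ`, so each must reach it.
        ρ+ρ≤∣I∣+∣J∣ : ρ + ρ ≤ ∣ I ∣ + ∣ J ∣
        ρ+ρ≤∣I∣+∣J∣ = ≤-trans (+-monoʳ-≤ ρ ρ≤∣B∣) le
        ρ≤∣I∣ : ρ ≤ ∣ I ∣
        ρ≤∣I∣ = m+m≤o+p∧p≤m⇒m≤o ρ ρ+ρ≤∣I∣+∣J∣ (ρ-bound indJ)
        ρ≤∣J∣ : ρ ≤ ∣ J ∣
        ρ≤∣J∣ = m+m≤o+p∧p≤m⇒m≤o ρ (subst (ρ + ρ ≤_) (+-comm ∣ I ∣ _) ρ+ρ≤∣I∣+∣J∣) (ρ-bound indI)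
        ρ≤∣B─D∪A∣ : ρ ≤ ∣ (B ─ D) ∪ A ∣
        ρ≤∣B─D∪A∣ = ≤-trans ρ≤∣I∣ (p⊆q⇒∣p∣≤∣q∣ I⊆)
        ρ≤∣C∪D∣ : ρ ≤ ∣ C ∪ D ∣
        ρ≤∣C∪D∣ = ≤-trans ρ≤∣J∣ (p⊆q⇒∣p∣≤∣q∣ J⊆)
        -- As each union has size at least `ρ`, this total caps the other at `ρ`; hence `I` and `J`
        -- fill the unions containing them.
        parts≤ρ+ρ : (∣ B ─ D ∣ + ∣ A ∣) + (∣ D ∣ + ∣ C ∣) ≤ ρ + ρ
        parts≤ρ+ρ = begin
          (∣ B ─ D ∣ + ∣ A ∣) + (∣ D ∣ + ∣ C ∣) ≡⟨ interchange ∣ B ─ D ∣ _ _ _ ⟩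
          (∣ B ─ D ∣ + ∣ D ∣) + (∣ A ∣ + ∣ C ∣) ≡⟨ cong (_+ (∣ A ∣ + ∣ C ∣)) (q⊆p⇒∣p─q∣+∣q∣≡∣p∣ D⊆B) ⟩
          ∣ B ∣ + (∣ A ∣ + ∣ C ∣)               ≤⟨ +-mono-≤ (ρ-bound indB) ∣A∣+∣C∣≤ρ ⟩
          ρ + ρ                                 ∎
        ∣D∣+∣C∣≤ρ : ∣ D ∣ + ∣ C ∣ ≤ ρ
        ∣D∣+∣C∣≤ρ = +-cancelˡ-≤ ρ _ _
          (≤-trans (+-monoˡ-≤ _ (≤-trans ρ≤∣B─D∪A∣ (∣p∪q∣≤∣p∣+∣q∣ (B ─ D) A))) parts≤ρ+ρ)
        ∣C∪D∣≤∣D∣+∣C∣ : ∣ C ∪ D ∣ ≤ ∣ D ∣ + ∣ C ∣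
        ∣C∪D∣≤∣D∣+∣C∣ = ≤-trans (∣p∪q∣≤∣p∣+∣q∣ C D) (≤-reflexive (+-comm ∣ C ∣ _))
        ∣C∪D∣≤ρ : ∣ C ∪ D ∣ ≤ ρ
        ∣C∪D∣≤ρ = ≤-trans ∣C∪D∣≤∣D∣+∣C∣ ∣D∣+∣C∣≤ρ
        ∣B─D∪A∣≤ρ : ∣ (B ─ D) ∪ A ∣ ≤ ρ
        ∣B─D∪A∣≤ρ = ≤-trans (∣p∪q∣≤∣p∣+∣q∣ (B ─ D) A) (+-cancelʳ-≤ ρ _ _
          (≤-trans (+-monoʳ-≤ _ (≤-trans ρ≤∣C∪D∣ ∣C∪D∣≤∣D∣+∣C∣)) parts≤ρ+ρ))

    -- `C` stays fixed along the chain. Together with the size of `C ∪ A`, the bound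
    -- `∣ A ∣ + ∣ C ∣ ≤ ρ` encodes that `A` and `C` are disjoint.
    exchange-chain : ∀ m (B : Fin m → Subset n) → (∀ i → IndepOfSize≥ ρ (B i)) →
      ∀ {A C} → IndepOfSize≥ ρ (C ∪ A) → ∣ A ∣ + ∣ C ∣ ≤ ρ →
      Σ (Fin (suc m) → Subset n) λ D → D zero ≡ A
        × (∀ i → D (suc i) ⊆ B i)
        × (∀ i → IndepOfSize≥ ρ ((B i ─ D (suc i)) ∪ D (inject₁ i)))
        × IndepOfSize≥ ρ (C ∪ D (fromℕ m))
    exchange-chain ℕ.zero _ _ {A} C∪A _ = (λ _ → A) , refl , (λ ()) , (λ ()) , C∪A
    exchange-chain (suc m) B bases {A} {C} C∪A ∣A∣+∣C∣≤ρ
      with exchange {A} {C} {B zero} (subst (IndepOfSize≥ ρ) (∪-comm C A) C∪A) ∣A∣+∣C∣≤ρ (bases zero)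
    ... | A′ , A′⊆B₀ , B₀─A′∪A , C∪A′ , ∣A′∣+∣C∣≤ρ
      with exchange-chain m (B ∘ suc) (bases ∘ suc) {A′} {C} C∪A′ ∣A′∣+∣C∣≤ρ
    ... | D , refl , D⊆B , B─D∪D , C∪D =
      D⁺ , refl ,
      (λ { zero → A′⊆B₀ ; (suc i) → D⊆B i }) ,
      (λ { zero → B₀─A′∪A ; (suc i) → B─D∪D i }) ,
      C∪D
      where
      D⁺ : Fin (suc (suc m)) → Subset n
      D⁺ zero    = A
      D⁺ (suc i) = D i

theorem1 : (n : ℕ) (M : Matroid n) (m : ℕ) → ℕ.suc m ≥ 2 →
    (B : Fin (ℕ.suc m) → Subset n) → (∀ i → IsBasis M (B i)) →
    (A₁ : Subset n) → A₁ ⊆ B zero →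
    Σ (Fin (ℕ.suc m) → Subset n) λ A → ( A zero ≡ A₁
    × (∀ i → A i ⊆ B i)
    × (∀ i → IsBasis M ((B i ─ A i) ∪ A (prev i))))
theorem1 n M m _ B bases A₁ A₁⊆B₀
  with exchange-chain M ρ-bound m (B ∘ suc) (large ∘ suc) {A₁} {B zero ─ A₁}
         ( indep-down M (∪-least (p─q⊆p (B zero) A₁) A₁⊆B₀) (proj₁ (bases zero))
         , p⊆q⇒∣p∣≤∣q∣ (p⊆p─q∪q (B zero) A₁) )
         (≤-reflexive (trans (+-comm ∣ A₁ ∣ _) (q⊆p⇒∣p─q∣+∣q∣≡∣p∣ A₁⊆B₀)))
  where
  ρ-bound : ∀ {X} → Indep M X → ∣ X ∣ ≤ ∣ B zero ∣
  ρ-bound = IsBasis⇒∣X∣≤∣B∣ M (bases zero)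
  large : ∀ i → IndepOfSize≥ M ∣ B zero ∣ (B i)
  large i = proj₁ (bases i) , IsBasis⇒∣X∣≤∣B∣ M (bases i) (proj₁ (bases zero))
... | A , refl , A⊆B , B─A∪A , C∪A =
  A , refl ,
  (λ { zero → A₁⊆B₀ ; (suc i) → A⊆B i }) ,
  -- Here `prev zero` is `fromℕ m` and `C` is `B zero ─ A₁`, so the end of the chain closes the
  -- cycle.
  (λ { zero    → IndepOfSize≥⇒IsBasis M (IsBasis⇒∣X∣≤∣B∣ M (bases zero)) C∪A
     ; (suc i) → IndepOfSize≥⇒IsBasis M (IsBasis⇒∣X∣≤∣B∣ M (bases zero)) (B─A∪A i) })
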